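{- Every forest is Hall-universal.
   Context: All graphs are finite and simple. For a finite set $V$, $\mathcal G(V)$ denotes the set of all finite simple undirected graphs with vertex set $V$, and $N_G(v)$ is the (open) neighborhood of $v$ in $G$. List coloring: for a graph $H$, a set of colors $S$ and $L:V(H)\to 2^S$, $H$ is $L$-colorable if there is a map $\varphi:V(H)\to S$ with $\varphi(v)\in L(v)$ for all $v$ and $\varphi(u)\ne\varphi(v)$ for every edge $uv\in E(H)$. For a subgraph $F$ of $H$ and $\sigma\in S$, $\alpha(F,L,\sigma)$ is the maximum size of an independent set $X\subseteq V(F)$ of $F$ with $\sigma\in L(v)$ for all $v\in X$. The pair $(H,L)$ satisfies Hall's condition if $|V(F)|\le\sum_{\sigma\in S}\alpha(F,L,\sigma)$ for every subgraph $F$ of $H$. Graphic lists: for $G,H\in\mathcal G(V)$, let $L(v)=N_G(v)$ for all $v\in V$ (with color set $S=V$). $H$ is $G$-colorable if $H$ is $L$-colorable, and $(H,G)$ satisfies Hall's condition if $(H,L)$ does. A graph $G\in\mathcal G(V)$ is Hall-universal if, for every $H\in\mathcal G(V)$ such that $(H,G)$ satisfies Hall's condition, $H$ is $G$-colorable. -}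

module Defs where

open import Data.Bool.Base using (true; false)
open import Data.Fin.Base using (Fin; zero; suc; inject₁; fromℕ)
open import Data.Fin.Properties using (all?)
open import Data.Fin.Subset using (Subset; inside; outside; _∈_; _⊆_; ∣_∣)
  renaming (⊥ to ∅)
open import Data.Fin.Subset.Properties using (_∈?_; _⊆?_; ⊥⊆; ∉⊥; ∣⊥∣≡0)
open import Data.List.Base using (List; []; _∷_; [_]; map; _++_; filter)
open import Data.List.Extrema.Nat using (max; argmax-sel; xs≤max)
open import Data.List.Membership.Propositional using () renaming (_∈_ to _∈ˡ_)
open import Data.List.Membership.Propositional.Properties
  using (∈-map⁺; ∈-map⁻; ∈-++⁺ˡ; ∈-++⁺ʳ; ∈-filter⁺; ∈-filter⁻)
open import Data.List.Relation.Unary.Any using (here)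
open import Data.List.Relation.Unary.All using (lookup)
open import Data.Nat.Base using (ℕ; zero; suc; _+_; _≤_)
open import Data.Nat.Properties using (+-0-commutativeMonoid)
open import Data.Product.Base using (Σ-syntax; ∃-syntax; _×_; _,_; proj₂)
open import Data.Sum.Base using (inj₁; inj₂)
open import Data.Vec.Base using ([]; _∷_; tabulate)
open import Function.Base using (id)
open import Function.Definitions using (Injective)
open import Relation.Binary.Core using (Rel)
open import Relation.Binary.Definitions using (Decidable; Symmetric; Irreflexive)
open import Relation.Binary.PropositionalEquality
  using (_≡_; _≢_; refl; sym; trans)
open import Relation.Nullary using (¬_; Dec; does)
open import Relation.Nullary.Decidable using (¬?; _×-dec_; _→-dec_)
open import Relation.Nullary.Negation using (contradiction)
open import Level using (0ℓ)

open import Algebra.Properties.CommutativeMonoid.Sum +-0-commutativeMonoid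
  using (sum-syntax)

-- The finite vertex set V is Fin n, so Graph n plays the role of 𝒢(V).
record Graph (n : ℕ) : Set₁ where
  field
    Adj    : Rel (Fin n) 0ℓ
    adj?   : Decidable Adj
    symm   : Symmetric Adj
    irrefl : Irreflexive _≡_ Adj

N : ∀ {n} → Graph n → Fin n → Subset n
N G v = tabulate λ u → does (Graph.adj? G v u)

-- Subgraphs are arbitrary, not necessarily induced or spanning.
record Subgraph {n} (H : Graph n) : Set₁ where
  field
    verts  : Subset n
    Edge   : Rel (Fin n) 0ℓ
    edge?  : Decidable Edge
    symm   : Symmetric Edge
    edge⊆  : ∀ {u v} → Edge u v → Graph.Adj H u v
    -- Symmetry of Edge makes this cover the other endpoint as well.
    source : ∀ {u v} → Edge u v → u ∈ verts

-- A cycle v₀ v₁ … v₍k+2₎ v₀ on k + 3 distinct vertices.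
record Cycle {n} (G : Graph n) : Set where
  open Graph G
  field
    k        : ℕ
    vertex   : Fin (3 + k) → Fin n
    distinct : Injective _≡_ _≡_ vertex
    step     : (i : Fin (2 + k)) → Adj (vertex (inject₁ i)) (vertex (suc i))
    close    : Adj (vertex (fromℕ (2 + k))) (vertex zero)

Forest : ∀ {n} → Graph n → Set
Forest G = ¬ Cycle G

Lists : ℕ → ℕ → Set
Lists n m = Fin n → Subset m

Colorable : ∀ {n m} → Graph n → Lists n m → Set
Colorable {n} {m} H L =
  Σ[ φ ∈ (Fin n → Fin m) ]
    (∀ v → φ v ∈ L v) × (∀ u v → Graph.Adj H u v → φ u ≢ φ v)

module _ {n m} {H : Graph n} (F : Subgraph H) (L : Lists n m) (σ : Fin m) where
  open Subgraph F

  -- X is an independent set of F all of whose vertices have σ in their list.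
  IndependentFor : Subset n → Set
  IndependentFor X =
    X ⊆ verts ×
    (∀ u v → u ∈ X → v ∈ X → ¬ Edge u v) ×
    (∀ v → v ∈ X → σ ∈ L v)

  independentFor? : ∀ X → Dec (IndependentFor X)
  independentFor? X =
    (X ⊆? verts) ×-dec
    (all? λ u → all? λ v → (u ∈? X) →-dec ((v ∈? X) →-dec ¬? (edge? u v))) ×-dec
    (all? λ v → (v ∈? X) →-dec (σ ∈? L v))

subsets : ∀ n → List (Subset n)
subsets zero    = [ [] ]
subsets (suc n) = map (outside ∷_) (subsets n) ++ map (inside ∷_) (subsets n)

-- The default value 0 is harmless: ∅ is always admissible.  That α is the
-- maximum is checked by α-attained and α-upper below.
α : ∀ {n m} {H : Graph n} → Subgraph H → Lists n m → Fin m → ℕ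
α {n} F L σ = max 0 (map ∣_∣ (filter (independentFor? F L σ) (subsets n)))

∈-subsets : ∀ {n} (X : Subset n) → X ∈ˡ subsets n
∈-subsets []          = here refl
∈-subsets (false ∷ X) = ∈-++⁺ˡ (∈-map⁺ (outside ∷_) (∈-subsets X))
∈-subsets {suc n} (true ∷ X) =
  ∈-++⁺ʳ (map (outside ∷_) (subsets n)) (∈-map⁺ (inside ∷_) (∈-subsets X))

module _ {n m} {H : Graph n} (F : Subgraph H) (L : Lists n m) (σ : Fin m) where

  α-upper : ∀ X → IndependentFor F L σ X → ∣ X ∣ ≤ α F L σ
  α-upper X ind = lookup (xs≤max 0 _)
    (∈-map⁺ ∣_∣ (∈-filter⁺ (independentFor? F L σ) (∈-subsets X) ind))

  α-attained : ∃[ X ] IndependentFor F L σ X × ∣ X ∣ ≡ α F L σ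
  α-attained with argmax-sel id 0 (map ∣_∣ (filter (independentFor? F L σ) (subsets n)))
  ... | inj₁ α≡0 =
    ∅ , (⊥⊆ , (λ _ _ u∈∅ → contradiction u∈∅ ∉⊥) , (λ _ v∈∅ → contradiction v∈∅ ∉⊥))
      , trans (∣⊥∣≡0 n) (sym α≡0)
  ... | inj₂ α∈ with ∈-map⁻ ∣_∣ α∈
  ...   | X , X∈ , α≡∣X∣ =
    X , proj₂ (∈-filter⁻ (independentFor? F L σ) {xs = subsets n} X∈) , sym α≡∣X∣

HallCondition : ∀ {n m} → Graph n → Lists n m → Set₁
HallCondition {m = m} H L =
  (F : Subgraph H) → ∣ Subgraph.verts F ∣ ≤ ∑[ σ < m ] α F L σ

HallUniversal : ∀ {n} → Graph n → Set₁
HallUniversal {n} G = (H : Graph n) → HallCondition H (N G) → Colorable H (N G)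

{-# OPTIONS --safe #-}
module Submission where

-- Fix a forest G and a graph H on V = Fin n, and call the elements of V
-- vertices or colours according to their role.  A colour σ is available at a
-- vertex v exactly when v and σ are adjacent in G.  The theorem follows from a
-- dichotomy (colouring-or-obstruction): either H is G-colorable, or there are a
-- set S of vertices and a set D of fewer than |S| colours such that D contains
-- every colour available in S, and any two vertices of S sharing a colour are
-- adjacent in H.  In the second case the subgraph F of H induced by S has
-- α(F,L,σ) ≤ 1 for σ in D and α(F,L,σ) = 0 otherwise, so the sum of the α's is
-- at most |D| < |S| = |V(F)|, and Hall's condition fails.
--
-- The dichotomy is proved for a set A of vertices and a set C of colours, by
-- induction on |C|.  If C is empty, any vertex of A is an obstruction by itself.
-- Otherwise some colour σ in C has an exceptional vertex u such that every
-- other vertex of A at which σ is available has no further colour in C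
-- (exists-pendant).  If not, one could walk forever in G, alternating between
-- colours and vertices and never turning back, which is impossible in a forest
-- (no-nonbacktracking-walk).  Let P be the set of these other vertices.
--   * If two vertices of P are adjacent in H, they form an obstruction.
--   * If P is independent and u has σ available and is adjacent in H to some v
--     in P, give colour σ to P and continue with A minus P and C minus σ.  A
--     later obstruction that contains u is repaired by adding v to S, σ to D.
--   * Otherwise the vertices of A at which σ is available are independent; they
--     all receive colour σ, and both they and σ are discarded.

open import Defs
open import Algebra.Properties.CommutativeMonoid.Sum
  using (sum)
open import Data.Bool.Base using (true; false)
open import Data.Fin.Base using (Fin; zero; suc; toℕ)
open import Data.Fin.Properties
  using (_≟_; any?; toℕ-injective; toℕ-inject₁; toℕ-fromℕ; toℕ<n; ℕ→Fin-notInjective)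
open import Data.Fin.Subset
  using (Subset; _∈_; _∉_; _⊆_; _∪_; ⁅_⁆; _-_; ∣_∣; Nonempty) renaming (⊤ to full; ⊥ to ∅)
open import Data.Fin.Subset.Properties
  using ( _∈?_; nonempty?; ∈⊤; ∣⊥∣≡0; ∣⁅x⁆∣≡1; x∈⁅x⁆; x∈⁅y⁆⇒x≡y
        ; p⊆q⇒∣p∣≤∣q∣; p⊂q⇒∣p∣<∣q∣; p⊆p∪q; x∈p∪q⁺; x∈p∪q⁻
        ; p─q⊆p; x∈p∧x≢y⇒x∈p-y; x∈p⇒∣p-x∣<∣p∣; ∪-identityʳ )
open import Data.Nat.Base using (ℕ; zero; suc; _+_; _≤_; _<_; z≤n; s≤s)
open import Data.Nat.Induction using (<-wellFounded)
open import Data.Nat.Properties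
  using ( +-0-commutativeMonoid; +-mono-≤; +-identityʳ; +-suc; +-monoʳ-<
        ; m≤n⇒m<n∨m≡n; m≤n⇒∃[o]m+o≡n; <-cmp; <⇒≱; <⇒≤; ≤-reflexive; ≤-trans
        ; <-irrefl; n<1+n; n≤1+n )
open import Data.Product.Base using (∃-syntax; _×_; _,_; proj₁; proj₂)
open import Data.Sum.Base using (_⊎_; inj₁; inj₂)
open import Data.Vec.Base using ([]; _∷_; there)
open import Data.Vec.Properties using (lookup∘tabulate; lookup⇒[]=; []=⇒lookup)
open import Function.Base using (_∘_; id)
open import Induction.WellFounded using (Acc; acc)
open import Level using (0ℓ)
open import Relation.Binary.Definitions using (tri<; tri≈; tri>)
open import Relation.Binary.PropositionalEquality
  using (_≡_; _≢_; refl; sym; trans; cong; subst; subst₂; ≢-sym)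
open import Relation.Nullary using (¬_; Dec; yes; no; does)
open import Relation.Nullary.Decidable
  using (¬?; _×-dec_; decidable-stable; dec-true)
open import Relation.Nullary.Negation using (contradiction)
open import Relation.Unary using (Pred; Decidable)

-- Finite subsets

x∉p-x : ∀ {n} (p : Subset n) x → x ∉ p - x
x∉p-x (false ∷ p) zero    ()
x∉p-x (true  ∷ p) zero    ()
x∉p-x (_     ∷ p) (suc x) (there x∈) = x∉p-x p x x∈

∣p∪⁅x⁆∣≤1+∣p∣ : ∀ {n} (p : Subset n) x → ∣ p ∪ ⁅ x ⁆ ∣ ≤ suc ∣ p ∣
∣p∪⁅x⁆∣≤1+∣p∣ (false ∷ p) zero    = s≤s (≤-reflexive (cong ∣_∣ (∪-identityʳ p)))
∣p∪⁅x⁆∣≤1+∣p∣ (true  ∷ p) zero    =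
  s≤s (≤-trans (≤-reflexive (cong ∣_∣ (∪-identityʳ p))) (n≤1+n _))
∣p∪⁅x⁆∣≤1+∣p∣ (false ∷ p) (suc x) = ∣p∪⁅x⁆∣≤1+∣p∣ p x
∣p∪⁅x⁆∣≤1+∣p∣ (true  ∷ p) (suc x) = s≤s (∣p∪⁅x⁆∣≤1+∣p∣ p x)

x∉p⇒∣p∣<∣p∪⁅x⁆∣ : ∀ {n} (p : Subset n) x → x ∉ p → ∣ p ∣ < ∣ p ∪ ⁅ x ⁆ ∣
x∉p⇒∣p∣<∣p∪⁅x⁆∣ p x x∉p =
  p⊂q⇒∣p∣<∣q∣ (p⊆p∪q ⁅ x ⁆ , x , x∈p∪q⁺ (inj₂ (x∈⁅x⁆ x)) , x∉p)

empty⇒∣p∣≤0 : ∀ {n} (p : Subset n) → (∀ x → x ∉ p) → ∣ p ∣ ≤ 0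
empty⇒∣p∣≤0 {n} p x∉p = ≤-trans
  (p⊆q⇒∣p∣≤∣q∣ {q = ∅} λ {x} x∈p → contradiction x∈p (x∉p x))
  (≤-reflexive (∣⊥∣≡0 n))

subsingleton⇒∣p∣≤1 : ∀ {n} (p : Subset n) → (∀ {x y} → x ∈ p → y ∈ p → x ≡ y) → ∣ p ∣ ≤ 1
subsingleton⇒∣p∣≤1 p equal with nonempty? p
... | no empty = ≤-trans (empty⇒∣p∣≤0 p (λ x x∈p → empty (x , x∈p))) z≤n
... | yes (x , x∈p) = ≤-trans
  (p⊆q⇒∣p∣≤∣q∣ λ y∈p → subst (_∈ ⁅ x ⁆) (equal x∈p y∈p) (x∈⁅x⁆ x))
  (≤-reflexive (∣⁅x⁆∣≡1 x))

sum≤∣p∣ : ∀ {m} (p : Subset m) (f : Fin m → ℕ) →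
          (∀ i → f i ≤ 1) → (∀ i → i ∉ p → f i ≤ 0) →
          sum +-0-commutativeMonoid f ≤ ∣ p ∣
sum≤∣p∣ []          f f≤1 f≤0 = z≤n
sum≤∣p∣ (true  ∷ p) f f≤1 f≤0 =
  +-mono-≤ (f≤1 zero) (sum≤∣p∣ p (f ∘ suc) (f≤1 ∘ suc) λ i i∉p →
    f≤0 (suc i) λ { (there i∈p) → i∉p i∈p })
sum≤∣p∣ (false ∷ p) f f≤1 f≤0 =
  +-mono-≤ (f≤0 zero λ ()) (sum≤∣p∣ p (f ∘ suc) (f≤1 ∘ suc) λ i i∉p →
    f≤0 (suc i) λ { (there i∈p) → i∉p i∈p })

-- Neighborhoods as lists

module _ {n} (G : Graph n) where
  open Graph G

  ∈N⁺ : ∀ {v σ} → Adj v σ → σ ∈ N G v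
  ∈N⁺ {v} {σ} v~σ =
    lookup⇒[]= σ _ (trans (lookup∘tabulate _ σ) (dec-true (adj? v σ) v~σ))

  ∈N⁻ : ∀ {v σ} → σ ∈ N G v → Adj v σ
  ∈N⁻ {v} {σ} σ∈N
    with adj? v σ
       | trans (sym (lookup∘tabulate (λ u → does (adj? v u)) σ)) ([]=⇒lookup σ∈N)
  ... | yes v~σ | _ = v~σ
  ... | no _    | ()

-- Walks in forests

module _ {n} {G : Graph n} (forest : Forest G) where
  open Graph G

  -- If x i is the first vertex visited again, at time j, then the vertices
  -- from time i up to time j - 1 form a cycle.
  no-nonbacktracking-walk :
    (x : ℕ → Fin n) → (∀ i → Adj (x i) (x (suc i))) → ¬ (∀ i → x (2 + i) ≢ x i)
  no-nonbacktracking-walk x step turn = ℕ→Fin-notInjective x inj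
    where
    first-return : ∀ d i → (∀ {a b} → a < b → b < i + d → x a ≢ x b) →
                   i < i + d → x i ≢ x (i + d)
    first-return 0 i _ i<i _ = <-irrefl (sym (+-identityʳ i)) i<i
    first-return 1 i _ _ eq =
      irrefl (trans eq (cong x (trans (+-suc i 0) (cong suc (+-identityʳ i))))) (step i)
    first-return 2 i _ _ eq = turn i (sym (trans eq (cong x
      (trans (+-suc i 1) (cong suc (trans (+-suc i 0) (cong suc (+-identityʳ i))))))))
    first-return (suc (suc (suc k))) i new _ eq = forest record
      { k        = k
      ; vertex   = λ a → x (i + toℕ a)
      ; distinct = distinct
      ; step     = λ a → subst₂ Adj
          (cong (λ t → x (i + t)) (sym (toℕ-inject₁ a))) (cong x (sym (+-suc i (toℕ a))))
          (step (i + toℕ a))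
      ; close    = subst₂ Adj
          (cong (λ t → x (i + t)) (sym (toℕ-fromℕ (2 + k))))
          (trans (cong x (sym (+-suc i (2 + k)))) (trans (sym eq) (cong x (sym (+-identityʳ i)))))
          (step (i + (2 + k)))
      }
      where
      distinct : ∀ {a b : Fin (3 + k)} → x (i + toℕ a) ≡ x (i + toℕ b) → a ≡ b
      distinct {a} {b} e with <-cmp (toℕ a) (toℕ b)
      ... | tri< a<b _ _ = contradiction e (new (+-monoʳ-< i a<b) (+-monoʳ-< i (toℕ<n b)))
      ... | tri≈ _ a≡b _ = toℕ-injective a≡b
      ... | tri> _ _ b<a = contradiction (sym e) (new (+-monoʳ-< i b<a) (+-monoʳ-< i (toℕ<n a)))

    new-below : ∀ k {i j} → i < j → j < k → x i ≢ x j
    new-below (suc k) {i} i<j (s≤s j≤k) with m≤n⇒m<n∨m≡n j≤k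
    ... | inj₁ j<k  = new-below k i<j j<k
    ... | inj₂ refl with m≤n⇒∃[o]m+o≡n (<⇒≤ i<j)
    ...   | d , refl = first-return d i (new-below k) i<j

    inj : ∀ {i j} → x i ≡ x j → i ≡ j
    inj {i} {j} e with <-cmp i j
    ... | tri< i<j _ _ = contradiction e (new-below (suc j) i<j (n<1+n j))
    ... | tri≈ _ i≡j _ = i≡j
    ... | tri> _ _ j<i = contradiction (sym e) (new-below (suc i) j<i (n<1+n i))

  module _ {A : Pred (Fin n) 0ℓ} (A? : Decidable A) (C : Subset n) where

    -- A walk that reaches the colour σ from u can continue without turning
    -- back, through a vertex of A other than u, to a colour of C other than σ.
    Continues : Fin n → Fin n → Set
    Continues σ u =
      ∃[ v ] A v × Adj v σ × v ≢ u × ∃[ τ ] τ ∈ C × Adj v τ × τ ≢ σ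

    continues? : ∀ σ u → Dec (Continues σ u)
    continues? σ u = any? λ v → A? v ×-dec adj? v σ ×-dec ¬? (v ≟ u) ×-dec
      any? λ τ → (τ ∈? C) ×-dec adj? v τ ×-dec ¬? (τ ≟ σ)

    module _ (continue : ∀ {σ} → σ ∈ C → ∀ u → Continues σ u) where

      -- A position of the walk together with what is needed to go on: the
      -- preceding vertex if the walk is at a colour, and the preceding and the
      -- following colour if it is at a vertex.
      data State : Set where
        at-colour : ∀ (u : Fin n) {σ} → σ ∈ C → State
        at-vertex : ∀ σ v {τ} → τ ∈ C → Adj v τ → τ ≢ σ → State

      position : State → Fin n
      position (at-colour _ {σ} _)     = σ
      position (at-vertex _ v _ _ _)   = v

      next : State → State
      next (at-colour u {σ} σ∈C) =
        let v , _ , _ , _ , _ , τ∈C , v~τ , τ≢σ = continue σ∈C u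
        in  at-vertex σ v τ∈C v~τ τ≢σ
      next (at-vertex _ v τ∈C _ _) = at-colour v τ∈C

      next-adjacent : ∀ s → Adj (position s) (position (next s))
      next-adjacent (at-colour u σ∈C)       = symm (proj₁ (proj₂ (proj₂ (continue σ∈C u))))
      next-adjacent (at-vertex _ _ _ v~τ _) = v~τ

      next-turn : ∀ s → position (next (next s)) ≢ position s
      next-turn (at-colour u σ∈C)       =
        proj₂ (proj₂ (proj₂ (proj₂ (proj₂ (proj₂ (proj₂ (continue σ∈C u)))))))
      next-turn (at-vertex _ v τ∈C _ _) = proj₁ (proj₂ (proj₂ (proj₂ (continue τ∈C v))))

      always-continues⇒C-empty : ¬ Nonempty C
      always-continues⇒C-empty (σ , σ∈C) = no-nonbacktracking-walk
        (position ∘ walk) (next-adjacent ∘ walk) (next-turn ∘ walk)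
        where
        walk : ℕ → State
        -- The walk has no preceding vertex at the start; any element does.
        walk zero    = at-colour σ σ∈C
        walk (suc i) = next (walk i)

    -- Every vertex of A at which σ is available, except possibly u, has no
    -- colour of C other than σ.  The vertex u need not be in A or have σ.
    Pendant : Fin n → Fin n → Set
    Pendant σ u = ∀ {v τ} → A v → Adj v σ → v ≢ u → τ ∈ C → Adj v τ → τ ≡ σ

    exists-pendant : Nonempty C → ∃[ σ ] ∃[ u ] σ ∈ C × Pendant σ u
    exists-pendant nonempty
      with any? (λ σ → (σ ∈? C) ×-dec any? (λ u → ¬? (continues? σ u)))
    ... | yes (σ , σ∈C , u , stuck) = σ , u , σ∈C ,
      λ {v} {τ} v∈A v~σ v≢u τ∈C v~τ → decidable-stable (τ ≟ σ)
        λ τ≢σ → stuck (v , v∈A , v~σ , v≢u , τ , τ∈C , v~τ , τ≢σ)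
    ... | no never-stuck = contradiction nonempty (always-continues⇒C-empty
      λ {σ} σ∈C u → decidable-stable (continues? σ u)
        λ stuck → never-stuck (σ , σ∈C , u , stuck))

-- Partial colourings and obstructions

module _ {n} (G H : Graph n) where
  private
    module G = Graph G
    module H = Graph H

  -- A proper colouring of the subgraph of H induced by A, with colours from C.
  -- The values outside A are irrelevant.
  record Colouring (A : Pred (Fin n) 0ℓ) (C : Subset n) : Set where
    field
      φ         : Fin n → Fin n
      colour∈C  : ∀ {v} → A v → φ v ∈ C
      available : ∀ {v} → A v → G.Adj v (φ v)
      proper    : ∀ {u v} → A u → A v → H.Adj u v → φ u ≢ φ v

  -- A set S of vertices of A with fewer than |S| colours of C available, each
  -- of them at a clique of H.  The set D may contain further colours.
  record Obstruction (A : Pred (Fin n) 0ℓ) (C : Subset n) : Set where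
    field
      S       : Subset n
      D       : Subset n
      S⊆A     : ∀ {v} → v ∈ S → A v
      ∣D∣<∣S∣ : ∣ D ∣ < ∣ S ∣
      colours : ∀ {v τ} → v ∈ S → τ ∈ C → G.Adj v τ → τ ∈ D
      clique  : ∀ {u v τ} → u ∈ S → v ∈ S → τ ∈ C → G.Adj u τ → G.Adj v τ →
                u ≢ v → H.Adj u v

  colourless⇒obstruction : ∀ {A C v} → A v → (∀ {τ} → τ ∈ C → ¬ G.Adj v τ) → Obstruction A C
  colourless⇒obstruction {A} {C} {v} v∈A none = record
    { S       = ⁅ v ⁆
    ; D       = ∅
    ; S⊆A     = λ w∈S → subst A (sym (x∈⁅y⁆⇒x≡y v w∈S)) v∈A
    ; ∣D∣<∣S∣ = ≤-reflexive (trans (cong suc (∣⊥∣≡0 n)) (sym (∣⁅x⁆∣≡1 v)))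
    ; colours = λ {w} {τ} w∈S τ∈C w~τ →
        contradiction (subst (λ w → G.Adj w τ) (x∈⁅y⁆⇒x≡y v w∈S) w~τ) (none τ∈C)
    ; clique  = λ a∈S b∈S _ _ _ a≢b →
        contradiction (trans (x∈⁅y⁆⇒x≡y v a∈S) (sym (x∈⁅y⁆⇒x≡y v b∈S))) a≢b
    }

  module _ {A : Pred (Fin n) 0ℓ} {C : Subset n} {σ : Fin n} where

    -- An independent set Q of vertices having σ available can receive colour σ
    -- once the rest of A is coloured without σ.
    extend-colouring :
      {Q : Pred (Fin n) 0ℓ} → Decidable Q → σ ∈ C →
      (∀ {v} → Q v → G.Adj v σ) → (∀ {u v} → Q u → Q v → ¬ H.Adj u v) →
      Colouring (λ v → A v × ¬ Q v) (C - σ) → Colouring A C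
    extend-colouring {Q} Q? σ∈C Q~σ independent K = record
      { φ = φ′ ; colour∈C = colour∈C′ ; available = available′ ; proper = proper′ }
      where
      open Colouring K

      φ′ : Fin n → Fin n
      φ′ v with Q? v
      ... | yes _ = σ
      ... | no  _ = φ v

      colour∈C′ : ∀ {v} → A v → φ′ v ∈ C
      colour∈C′ {v} v∈A with Q? v
      ... | yes _   = σ∈C
      ... | no  v∉Q = p─q⊆p C ⁅ σ ⁆ (colour∈C (v∈A , v∉Q))

      available′ : ∀ {v} → A v → G.Adj v (φ′ v)
      available′ {v} v∈A with Q? v
      ... | yes v∈Q = Q~σ v∈Q
      ... | no  v∉Q = available (v∈A , v∉Q)

      φ≢σ : ∀ {v} → A v → ¬ Q v → φ v ≢ σ
      φ≢σ v∈A v∉Q eq = x∉p-x C σ (subst (_∈ C - σ) eq (colour∈C (v∈A , v∉Q)))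

      proper′ : ∀ {u v} → A u → A v → H.Adj u v → φ′ u ≢ φ′ v
      proper′ {u} {v} u∈A v∈A u~v with Q? u | Q? v
      ... | yes u∈Q | yes v∈Q = contradiction u~v (independent u∈Q v∈Q)
      ... | yes _   | no  v∉Q = ≢-sym (φ≢σ v∈A v∉Q)
      ... | no  u∉Q | yes _   = φ≢σ u∈A u∉Q
      ... | no  u∉Q | no  v∉Q = proper (u∈A , u∉Q) (v∈A , v∉Q) u~v

    module _ {B : Pred (Fin n) 0ℓ} (B⊆A : ∀ {v} → B v → A v) (O : Obstruction B (C - σ)) where
      open Obstruction O

      restore-colour : (∀ {v} → v ∈ S → ¬ G.Adj v σ) → Obstruction A C
      restore-colour S≁σ = record
        { S       = S
        ; D       = D
        ; S⊆A     = B⊆A ∘ S⊆A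
        ; ∣D∣<∣S∣ = ∣D∣<∣S∣
        ; colours = λ v∈S τ∈C v~τ → colours v∈S (τ∈C-σ v∈S τ∈C v~τ) v~τ
        ; clique  = λ u∈S v∈S τ∈C u~τ → clique u∈S v∈S (τ∈C-σ u∈S τ∈C u~τ) u~τ
        }
        where
        τ∈C-σ : ∀ {v τ} → v ∈ S → τ ∈ C → G.Adj v τ → τ ∈ C - σ
        τ∈C-σ v∈S τ∈C v~τ = x∈p∧x≢y⇒x∈p-y τ∈C λ { refl → S≁σ v∈S v~τ }

      -- If u is the only vertex of S at which σ is available, the colour σ is
      -- paid for by an H-neighbour v of u whose only colour in C is σ.
      add-pendant-vertex :
        ∀ {u v} → A v → v ∉ S → (∀ {τ} → τ ∈ C → G.Adj v τ → τ ≡ σ) → H.Adj u v →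
        (∀ {w} → w ∈ S → G.Adj w σ → w ≡ u) → Obstruction A C
      add-pendant-vertex {u} {v} v∈A v∉S only-σ u~v only-u = record
        { S       = S ∪ ⁅ v ⁆
        ; D       = D ∪ ⁅ σ ⁆
        ; S⊆A     = λ w∈S′ → S′⊆A (x∈p∪q⁻ S ⁅ v ⁆ w∈S′)
        ; ∣D∣<∣S∣ = ≤-trans (s≤s (∣p∪⁅x⁆∣≤1+∣p∣ D σ))
                            (≤-trans (s≤s ∣D∣<∣S∣) (x∉p⇒∣p∣<∣p∪⁅x⁆∣ S v v∉S))
        ; colours = λ w∈S′ → colours′ (x∈p∪q⁻ S ⁅ v ⁆ w∈S′)
        ; clique  = λ a∈S′ b∈S′ → clique′ (x∈p∪q⁻ S ⁅ v ⁆ a∈S′) (x∈p∪q⁻ S ⁅ v ⁆ b∈S′)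
        }
        where
        S′⊆A : ∀ {w} → w ∈ S ⊎ w ∈ ⁅ v ⁆ → A w
        S′⊆A (inj₁ w∈S) = B⊆A (S⊆A w∈S)
        S′⊆A (inj₂ w∈v) = subst A (sym (x∈⁅y⁆⇒x≡y v w∈v)) v∈A

        colours′ : ∀ {w τ} → w ∈ S ⊎ w ∈ ⁅ v ⁆ → τ ∈ C → G.Adj w τ → τ ∈ D ∪ ⁅ σ ⁆
        colours′ {τ = τ} w∈S′ τ∈C w~τ with τ ≟ σ
        ... | yes refl = x∈p∪q⁺ (inj₂ (x∈⁅x⁆ σ))
        colours′ (inj₁ w∈S) τ∈C w~τ | no τ≢σ =
          x∈p∪q⁺ (inj₁ (colours w∈S (x∈p∧x≢y⇒x∈p-y τ∈C τ≢σ) w~τ))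
        colours′ (inj₂ w∈v) τ∈C w~τ | no τ≢σ with refl ← x∈⁅y⁆⇒x≡y v w∈v =
          contradiction (only-σ τ∈C w~τ) τ≢σ

        v~S : ∀ {w τ} → w ∈ S → τ ∈ C → G.Adj w τ → G.Adj v τ → H.Adj w v
        v~S w∈S τ∈C w~τ v~τ with refl ← only-σ τ∈C v~τ with refl ← only-u w∈S w~τ = u~v

        clique′ : ∀ {a b τ} → a ∈ S ⊎ a ∈ ⁅ v ⁆ → b ∈ S ⊎ b ∈ ⁅ v ⁆ → τ ∈ C →
                  G.Adj a τ → G.Adj b τ → a ≢ b → H.Adj a b
        clique′ {τ = τ} (inj₁ a∈S) (inj₁ b∈S) τ∈C a~τ b~τ a≢b with τ ≟ σ
        ... | yes refl = contradiction (trans (only-u a∈S a~τ) (sym (only-u b∈S b~τ))) a≢b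
        ... | no  τ≢σ  = clique a∈S b∈S (x∈p∧x≢y⇒x∈p-y τ∈C τ≢σ) a~τ b~τ a≢b
        clique′ (inj₁ a∈S) (inj₂ b∈v) τ∈C a~τ b~τ _ with refl ← x∈⁅y⁆⇒x≡y v b∈v =
          v~S a∈S τ∈C a~τ b~τ
        clique′ (inj₂ a∈v) (inj₁ b∈S) τ∈C a~τ b~τ _ with refl ← x∈⁅y⁆⇒x≡y v a∈v =
          H.symm (v~S b∈S τ∈C b~τ a~τ)
        clique′ (inj₂ a∈v) (inj₂ b∈v) _ _ _ a≢b =
          contradiction (trans (x∈⁅y⁆⇒x≡y v a∈v) (sym (x∈⁅y⁆⇒x≡y v b∈v))) a≢b

  -- Induction on the set of colours

  colouring-or-obstruction :
    Forest G → ∀ C → Acc _<_ ∣ C ∣ → {A : Pred (Fin n) 0ℓ} → Decidable A →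
    Colouring A C ⊎ Obstruction A C
  colouring-or-obstruction forest C (acc rec) {A} A? with nonempty? C
  ... | no C-empty with any? A?
  ...   | yes (v , v∈A) = inj₂ (colourless⇒obstruction v∈A λ τ∈C _ → C-empty (_ , τ∈C))
  ...   | no  A-empty   = inj₁ record
    { φ         = id
    ; colour∈C  = λ v∈A → contradiction (_ , v∈A) A-empty
    ; available = λ v∈A → contradiction (_ , v∈A) A-empty
    ; proper    = λ v∈A → contradiction (_ , v∈A) A-empty
    }
  colouring-or-obstruction forest C (acc rec) {A} A? | yes C-nonempty
    with σ , u , σ∈C , pendant ← exists-pendant forest A? C C-nonempty = by-conflicts
    where
    -- The vertices of A at which σ is available.
    Q : Pred (Fin n) 0ℓ
    Q v = A v × G.Adj v σ

    Q? : Decidable Q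
    Q? v = A? v ×-dec G.adj? v σ

    -- Those of them other than u.  They have no colour of C besides σ.
    P : Pred (Fin n) 0ℓ
    P v = Q v × v ≢ u

    P? : Decidable P
    P? v = Q? v ×-dec ¬? (v ≟ u)

    only-σ : ∀ {v τ} → P v → τ ∈ C → G.Adj v τ → τ ≡ σ
    only-σ ((v∈A , v~σ) , v≢u) = pendant v∈A v~σ v≢u

    without : ∀ {R : Pred (Fin n) 0ℓ} → Decidable R →
              Colouring (λ v → A v × ¬ R v) (C - σ) ⊎ Obstruction (λ v → A v × ¬ R v) (C - σ)
    without R? = colouring-or-obstruction forest (C - σ) (rec (x∈p⇒∣p-x∣<∣p∣ σ∈C))
      λ v → A? v ×-dec ¬? (R? v)

    -- Without σ, the vertex v alone is an obstruction.
    adjacent-in-P : ∀ {v w} → P v → P w → H.Adj v w → Obstruction A C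
    adjacent-in-P {v} {w} v∈P w∈P v~w = add-pendant-vertex {B = A} id
      alone (proj₁ (proj₁ w∈P)) (λ w∈v → H.irrefl (sym (x∈⁅y⁆⇒x≡y v w∈v)) v~w)
      (only-σ w∈P) v~w (λ x∈v _ → x∈⁅y⁆⇒x≡y v x∈v)
      where
      alone : Obstruction A (C - σ)
      alone = colourless⇒obstruction (proj₁ (proj₁ v∈P)) λ τ∈C-σ v~τ → x∉p-x C σ
        (subst (_∈ C - σ) (only-σ v∈P (p─q⊆p C ⁅ σ ⁆ τ∈C-σ) v~τ) τ∈C-σ)

    u-conflicts : (∀ {v w} → P v → P w → ¬ H.Adj v w) →
                  ∀ {v} → P v → H.Adj u v → Colouring A C ⊎ Obstruction A C
    u-conflicts independent {v} v∈P u~v with without P?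
    ... | inj₁ K = inj₁ (extend-colouring P? σ∈C (proj₂ ∘ proj₁) independent K)
    ... | inj₂ O = inj₂ (repair (u ∈? S))
      where
      open Obstruction O

      only-u : ∀ {w} → w ∈ S → G.Adj w σ → w ≡ u
      only-u {w} w∈S w~σ = decidable-stable (w ≟ u)
        λ w≢u → proj₂ (S⊆A w∈S) ((proj₁ (S⊆A w∈S) , w~σ) , w≢u)

      repair : Dec (u ∈ S) → Obstruction A C
      repair (yes _)   = add-pendant-vertex proj₁ O (proj₁ (proj₁ v∈P))
        (λ v∈S → proj₂ (S⊆A v∈S) v∈P) (only-σ v∈P) u~v only-u
      repair (no  u∉S) = restore-colour proj₁ O
        λ w∈S w~σ → u∉S (subst (_∈ S) (only-u w∈S w~σ) w∈S)

    no-conflict : (∀ {v w} → Q v → Q w → ¬ H.Adj v w) → Colouring A C ⊎ Obstruction A C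
    no-conflict independent with without Q?
    ... | inj₁ K = inj₁ (extend-colouring Q? σ∈C proj₂ independent K)
    ... | inj₂ O = inj₂ (restore-colour proj₁ O
      λ w∈S w~σ → let w∈A , w∉Q = Obstruction.S⊆A O w∈S in w∉Q (w∈A , w~σ))

    by-conflicts : Colouring A C ⊎ Obstruction A C
    by-conflicts with any? (λ v → any? λ w → P? v ×-dec P? w ×-dec H.adj? v w)
    ... | yes (v , w , v∈P , w∈P , v~w) = inj₂ (adjacent-in-P v∈P w∈P v~w)
    ... | no  P-independent with any? (λ v → P? v ×-dec H.adj? u v)
    ...   | yes (v , v∈P , u~v) =
      u-conflicts (λ v∈P w∈P v~w → P-independent (_ , _ , v∈P , w∈P , v~w)) v∈P u~v
    ...   | no  u-independent = no-conflict independent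
      where
      independent : ∀ {v w} → Q v → Q w → ¬ H.Adj v w
      independent {v} {w} v∈Q w∈Q v~w with v ≟ u | w ≟ u
      ... | yes refl | yes refl = H.irrefl refl v~w
      ... | yes refl | no  w≢u  = u-independent (w , (w∈Q , w≢u) , v~w)
      ... | no  v≢u  | yes refl = u-independent (v , (v∈Q , v≢u) , H.symm v~w)
      ... | no  v≢u  | no  w≢u  = P-independent (v , w , (v∈Q , v≢u) , (w∈Q , w≢u) , v~w)

  -- Obstructions violate Hall's condition

  -- The subgraph of H induced by S.
  induced : Subset n → Subgraph H
  induced S = record
    { verts  = S
    ; Edge   = λ u v → u ∈ S × v ∈ S × H.Adj u v
    ; edge?  = λ u v → (u ∈? S) ×-dec (v ∈? S) ×-dec H.adj? u v
    ; symm   = λ (u∈S , v∈S , u~v) → v∈S , u∈S , H.symm u~v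
    ; edge⊆  = λ (_ , _ , u~v) → u~v
    ; source = λ (u∈S , _ , _) → u∈S
    }

  obstruction⇒¬Hall : ∀ {A} → Obstruction A full → ¬ HallCondition H (N G)
  obstruction⇒¬Hall O hall = <⇒≱ ∣D∣<∣S∣
    (≤-trans (hall F) (sum≤∣p∣ D (α F (N G)) α≤1 α≤0))
    where
    open Obstruction O
    F : Subgraph H
    F = induced S

    α≤1 : ∀ σ → α F (N G) σ ≤ 1
    α≤1 σ with X , (X⊆S , no-edge , σ∈N) , ∣X∣≡α ← α-attained F (N G) σ =
      subst (_≤ 1) ∣X∣≡α (subsingleton⇒∣p∣≤1 X λ {u} {v} u∈X v∈X →
        decidable-stable (u ≟ v) λ u≢v →
          no-edge u v u∈X v∈X (X⊆S u∈X , X⊆S v∈X ,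
            clique (X⊆S u∈X) (X⊆S v∈X) ∈⊤ (∈N⁻ G (σ∈N u u∈X)) (∈N⁻ G (σ∈N v v∈X)) u≢v))

    α≤0 : ∀ σ → σ ∉ D → α F (N G) σ ≤ 0
    α≤0 σ σ∉D with X , (X⊆S , _ , σ∈N) , ∣X∣≡α ← α-attained F (N G) σ =
      subst (_≤ 0) ∣X∣≡α (empty⇒∣p∣≤0 X λ v v∈X →
        σ∉D (colours (X⊆S v∈X) ∈⊤ (∈N⁻ G (σ∈N v v∈X))))

theorem4p11 : (n : ℕ) (G : Graph n) → Forest G → HallUniversal G
theorem4p11 n G forest H hall
  with colouring-or-obstruction G H forest full (<-wellFounded _) {A = _∈ full} (_∈? full)
... | inj₁ K = φ , (λ _ → ∈N⁺ G (available ∈⊤)) , (λ _ _ → proper ∈⊤ ∈⊤)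
  where open Colouring K
... | inj₂ O = contradiction hall (obstruction⇒¬Hall G H O)
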